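{- For non-negative integers $n,k,\alpha,\beta$, $$\genfrac{\lfloor}{\rfloor}{0pt}{}{n+k}{n}^{\alpha,\beta}=\sum_{1\le i_1\le i_2\le\cdots\le i_k\le n}\ \prod_{j=1}^{k}\big((\alpha+\beta)i_j+\alpha(j-1)\big)=\sum_{1\le i_1\le\cdots\le i_k\le n}(\alpha+\beta)i_1\big((\alpha+\beta)i_2+\alpha\big)\cdots\big((\alpha+\beta)i_k+\alpha(k-1)\big).$$
   Context: For parameters $\alpha,\beta$, the generalized Stirling numbers $\genfrac{\lfloor}{\rfloor}{0pt}{}{n}{k}^{\alpha,\beta}$, $0\le k\le n$, are defined by the polynomial identity in $x$ $$x(x+\alpha)\cdots(x+(n-1)\alpha)=\sum_{k=0}^{n}\genfrac{\lfloor}{\rfloor}{0pt}{}{n}{k}^{\alpha,\beta}\,x(x-\beta)\cdots(x-(k-1)\beta),$$ (empty products equal $1$), and $\genfrac{\lfloor}{\rfloor}{0pt}{}{n}{k}^{\alpha,\beta}=0$ for $k<0$ or $k>n$. An empty sum is $0$ and an empty product is $1$ (so for $k=0$ the right-hand side equals $1$). -}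

module Defs where

open import Data.Empty using (⊥-elim)
open import Data.Fin.Base using (toℕ)
open import Data.Integer.Base as ℤ using (ℤ; +_; -[1+_]; 0ℤ; 1ℤ)
import Data.Integer.Properties as ℤ
open import Data.Integer.Solver using (module +-*-Solver)
open import Data.List.Base
  using (List; []; _∷_; map; filter; tabulate; applyUpTo; cartesianProductWith)
open import Data.Nat.Base as ℕ using (ℕ; zero; suc; z≤n; s≤s)
open import Data.Nat.ListAction using (sum; product)
import Data.Nat.Properties as ℕ
open import Data.Product.Base using (∃-syntax; _,_; proj₁; proj₂)
open import Data.Vec.Base using (Vec; []; _∷_; lookup)
open import Data.Vec.Relation.Unary.Linked using (linked?)
open import Relation.Binary.PropositionalEquality
open import Relation.Nullary.Decidable using (yes; no)

------------------------------------------------------------------------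
-- Polynomials over ℤ

-- a₀ ∷ a₁ ∷ … ∷ aₘ ∷ [] is a₀ + a₁ x + … + aₘ xᵐ.  Trailing zeros are
-- allowed, so the equality of polynomials is _≈ₚ_ and not _≡_.

Poly : Set
Poly = List ℤ

coeff : Poly → ℕ → ℤ
coeff []      _       = 0ℤ
coeff (a ∷ p) zero    = a
coeff (a ∷ p) (suc m) = coeff p m

infix  4 _≈ₚ_
infixl 6 _+ₚ_
infixl 7 _*ₚ_ _·ₚ_

_≈ₚ_ : Poly → Poly → Set
p ≈ₚ q = ∀ m → coeff p m ≡ coeff q m

_+ₚ_ : Poly → Poly → Poly
[]      +ₚ q       = q
(a ∷ p) +ₚ []      = a ∷ p
(a ∷ p) +ₚ (b ∷ q) = (a ℤ.+ b) ∷ (p +ₚ q)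

_·ₚ_ : ℤ → Poly → Poly
c ·ₚ p = map (c ℤ.*_) p

_*ₚ_ : Poly → Poly → Poly
[]      *ₚ q = []
(a ∷ p) *ₚ q = (a ·ₚ q) +ₚ (0ℤ ∷ p *ₚ q)

x+_ : ℤ → Poly
x+ c = c ∷ 1ℤ ∷ []

-- f 0 + f 1 + … + f (n − 1)
∑ₚ< : ℕ → (ℕ → Poly) → Poly
∑ₚ< zero    f = []
∑ₚ< (suc n) f = ∑ₚ< n f +ₚ f n

-- f 0 * f 1 * … * f (n − 1)
∏ₚ< : ℕ → (ℕ → Poly) → Poly
∏ₚ< zero    f = 1ℤ ∷ []
∏ₚ< (suc n) f = ∏ₚ< n f *ₚ f n

------------------------------------------------------------------------
-- Generalized Stirling numbers

-- x (x + α) ⋯ (x + (n − 1) α)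
rising : ℤ → ℕ → Poly
rising α n = ∏ₚ< n (λ i → x+ (+ i ℤ.* α))

-- x (x − β) ⋯ (x − (k − 1) β)
falling : ℤ → ℕ → Poly
falling β k = ∏ₚ< k (λ i → x+ (ℤ.- (+ i ℤ.* β)))

-- The numbers are given by their defining polynomial identity.  The
-- record is inhabited for all α and β: see generalizedStirling-exists.
record IsGeneralizedStirling (α β : ℤ) (S : ℕ → ℤ → ℤ) : Set where
  field
    expansion : ∀ n → rising α n ≈ₚ ∑ₚ< (suc n) (λ k → S n (+ k) ·ₚ falling β k)
    k<0⇒0     : ∀ n k → k ℤ.< 0ℤ → S n k ≡ 0ℤ
    k>n⇒0     : ∀ n k → + n ℤ.< k → S n k ≡ 0ℤ

------------------------------------------------------------------------
-- Sums over 1 ≤ i₁ ≤ ⋯ ≤ iₖ ≤ n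

-- All k-tuples with entries in the given list.
tuples : ∀ {A : Set} k → List A → List (Vec A k)
tuples zero    xs = [] ∷ []
tuples (suc k) xs = cartesianProductWith _∷_ xs (tuples k xs)

-- All (i₁, …, iₖ) with 1 ≤ i₁ ≤ ⋯ ≤ iₖ ≤ n, each listed once.
weaklyIncreasing : ∀ k n → List (Vec ℕ k)
weaklyIncreasing k n = filter (linked? ℕ._≤?_) (tuples k (applyUpTo suc n))

∑-weaklyIncreasing : ∀ k n → (Vec ℕ k → ℕ) → ℕ
∑-weaklyIncreasing k n f = sum (map f (weaklyIncreasing k n))

-- The index j : Fin k starts at 0, so toℕ j stands for j − 1 with 1 ≤ j ≤ k.
weight : ∀ {k} → ℕ → ℕ → Vec ℕ k → ℕ
weight α β is = product (tabulate λ j →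
  (α ℕ.+ β) ℕ.* lookup is j ℕ.+ α ℕ.* toℕ j)

-- ((α + β) i₁ + α m) ((α + β) i₂ + α (m + 1)) ⋯
shiftedWeight : ∀ {k} → ℕ → ℕ → ℕ → Vec ℕ k → ℕ
shiftedWeight α β m []       = 1
shiftedWeight α β m (i ∷ is) =
  ((α ℕ.+ β) ℕ.* i ℕ.+ α ℕ.* m) ℕ.* shiftedWeight α β (suc m) is

-- (α + β) i₁ ((α + β) i₂ + α) ⋯ ((α + β) iₖ + α (k − 1))
expandedWeight : ∀ {k} → ℕ → ℕ → Vec ℕ k → ℕ
expandedWeight α β []       = 1
expandedWeight α β (i ∷ is) = ((α ℕ.+ β) ℕ.* i) ℕ.* shiftedWeight α β 1 is

------------------------------------------------------------------------
-- Existence of the generalized Stirling numbers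

private
  coeff-+ : ∀ p q m → coeff (p +ₚ q) m ≡ coeff p m ℤ.+ coeff q m
  coeff-+ []      q       m       = sym (ℤ.+-identityˡ _)
  coeff-+ (a ∷ p) []      m       = sym (ℤ.+-identityʳ _)
  coeff-+ (a ∷ p) (b ∷ q) zero    = refl
  coeff-+ (a ∷ p) (b ∷ q) (suc m) = coeff-+ p q m

  coeff-· : ∀ c p m → coeff (c ·ₚ p) m ≡ c ℤ.* coeff p m
  coeff-· c []      m       = sym (ℤ.*-zeroʳ c)
  coeff-· c (a ∷ p) zero    = refl
  coeff-· c (a ∷ p) (suc m) = coeff-· c p m

  coeff-*-x+ : ∀ p c m →
    coeff (p *ₚ (x+ c)) (suc m) ≡ coeff p m ℤ.+ coeff p (suc m) ℤ.* c
  coeff-*-x+ []      c m       = refl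
  coeff-*-x+ (a ∷ p) c zero    =
    trans (coeff-+ (a ·ₚ (1ℤ ∷ [])) (p *ₚ (x+ c)) 0)
          (cong₂ ℤ._+_ (ℤ.*-identityʳ a) (const p))
    where
    const : ∀ p → coeff (p *ₚ (x+ c)) 0 ≡ coeff p 0 ℤ.* c
    const []      = refl
    const (b ∷ p) = ℤ.+-identityʳ _
  coeff-*-x+ (a ∷ p) c (suc m) =
    trans (coeff-+ (a ·ₚ (1ℤ ∷ [])) (p *ₚ (x+ c)) (suc m))
          (trans (ℤ.+-identityˡ _) (coeff-*-x+ p c m))

  module _ (f : ℕ → ℤ) where

    P : ℕ → Poly
    P n = ∏ₚ< n (λ i → x+ f i)

    P-bounded : ∀ n m → n ℕ.< m → coeff (P n) m ≡ 0ℤ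
    P-bounded zero    (suc m) _         = refl
    P-bounded (suc n) (suc m) (s≤s n<m)
      rewrite coeff-*-x+ (P n) (f n) m
            | P-bounded n m n<m
            | P-bounded n (suc m) (ℕ.m<n⇒m<1+n n<m) = refl

    P-monic : ∀ n → coeff (P n) n ≡ 1ℤ
    P-monic zero = refl
    P-monic (suc n)
      rewrite coeff-*-x+ (P n) (f n) n
            | P-monic n
            | P-bounded n (suc n) ℕ.≤-refl = refl

  ∑-cong : ∀ n {f g : ℕ → Poly} → (∀ k → k ℕ.< n → f k ≡ g k) → ∑ₚ< n f ≡ ∑ₚ< n g
  ∑-cong zero    eq = refl
  ∑-cong (suc n) eq =
    cong₂ _+ₚ_ (∑-cong n λ k k<n → eq k (ℕ.m<n⇒m<1+n k<n)) (eq n ℕ.≤-refl)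

  update : ℕ → ℤ → (ℕ → ℤ) → ℕ → ℤ
  update n a c k with k ℕ.≟ n
  ... | yes _ = a
  ... | no  _ = c k

  update-≡ : ∀ n a c → update n a c n ≡ a
  update-≡ n a c with n ℕ.≟ n
  ... | yes _  = refl
  ... | no n≢n = ⊥-elim (n≢n refl)

  update-< : ∀ n a c k → k ℕ.< n → update n a c k ≡ c k
  update-< n a c k k<n with k ℕ.≟ n
  ... | yes k≡n = ⊥-elim (ℕ.<⇒≢ k<n k≡n)
  ... | no  _   = refl

  module _ (b : ℕ → Poly)
           (monic   : ∀ n → coeff (b n) n ≡ 1ℤ)
           (bounded : ∀ n m → n ℕ.< m → coeff (b n) m ≡ 0ℤ) where

    expand : ∀ n p → (∀ m → n ℕ.≤ m → coeff p m ≡ 0ℤ) →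
             ∃[ c ] p ≈ₚ ∑ₚ< n (λ k → c k ·ₚ b k)
    expand zero    p deg = (λ _ → 0ℤ) , λ m → deg m z≤n
    expand (suc n) p deg = update n a c , eq
      where
      a = coeff p n
      q = p +ₚ ((ℤ.- a) ·ₚ b n)

      coeff-q : ∀ m → coeff q m ≡ coeff p m ℤ.+ (ℤ.- a) ℤ.* coeff (b n) m
      coeff-q m = trans (coeff-+ p _ m) (cong (λ y → coeff p m ℤ.+ y) (coeff-· (ℤ.- a) (b n) m))

      deg-q : ∀ m → n ℕ.≤ m → coeff q m ≡ 0ℤ
      deg-q m n≤m with n ℕ.≟ m
      ... | yes refl rewrite coeff-q n | monic n =
        solve 1 (λ y → y :+ :- y :* con 1ℤ := con 0ℤ) refl a
        where open +-*-Solver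
      ... | no n≢m rewrite coeff-q m
                         | deg m (ℕ.≤∧≢⇒< n≤m n≢m)
                         | bounded n m (ℕ.≤∧≢⇒< n≤m n≢m) =
        solve 1 (λ y → con 0ℤ :+ :- y :* con 0ℤ := con 0ℤ) refl a
        where open +-*-Solver

      c  = proj₁ (expand n q deg-q)
      ih = proj₂ (expand n q deg-q)

      eq : p ≈ₚ ∑ₚ< (suc n) (λ k → update n a c k ·ₚ b k)
      eq m = begin
        coeff p m
          ≡⟨ solve 3 (λ x y z → x := (x :+ :- y :* z) :+ y :* z) refl
               (coeff p m) a (coeff (b n) m) ⟩
        (coeff p m ℤ.+ (ℤ.- a) ℤ.* coeff (b n) m) ℤ.+ a ℤ.* coeff (b n) m
          ≡⟨ cong₂ ℤ._+_ (trans (sym (coeff-q m)) (ih m)) (sym (coeff-· a (b n) m)) ⟩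
        coeff (∑ₚ< n (λ k → c k ·ₚ b k)) m ℤ.+ coeff (a ·ₚ b n) m
          ≡⟨ sym (coeff-+ (∑ₚ< n (λ k → c k ·ₚ b k)) _ m) ⟩
        coeff (∑ₚ< n (λ k → c k ·ₚ b k) +ₚ a ·ₚ b n) m
          ≡⟨ cong₂ (λ s t → coeff (s +ₚ t ·ₚ b n) m)
               (∑-cong n λ k k<n → cong (_·ₚ b k) (sym (update-< n a c k k<n)))
               (sym (update-≡ n a c)) ⟩
        coeff (∑ₚ< (suc n) (λ k → update n a c k ·ₚ b k)) m ∎
        where
        open ≡-Reasoning
        open +-*-Solver

  truncate : ℕ → (ℕ → ℤ) → ℤ → ℤ
  truncate n c (+ k) with k ℕ.≤? n
  ... | yes _ = c k
  ... | no  _ = 0ℤ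
  truncate n c -[1+ k ] = 0ℤ

  truncate-≤ : ∀ n c k → k ℕ.≤ n → truncate n c (+ k) ≡ c k
  truncate-≤ n c k k≤n with k ℕ.≤? n
  ... | yes _  = refl
  ... | no k≰n = ⊥-elim (k≰n k≤n)

  truncate-neg : ∀ n c k → k ℤ.< 0ℤ → truncate n c k ≡ 0ℤ
  truncate-neg n c -[1+ k ] _ = refl
  truncate-neg n c (+ k) (ℤ.+<+ ())

  truncate-> : ∀ n c k → + n ℤ.< k → truncate n c k ≡ 0ℤ
  truncate-> n c (+ k) (ℤ.+<+ n<k) with k ℕ.≤? n
  ... | yes k≤n = ⊥-elim (ℕ.<⇒≱ n<k k≤n)
  ... | no  _   = refl

generalizedStirling-exists : ∀ α β → ∃[ S ] IsGeneralizedStirling α β S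
generalizedStirling-exists α β = (λ n → truncate n (c n)) , record
  { expansion = λ n m → trans (proj₂ (e n) m)
      (cong (λ p → coeff p m) (∑-cong (suc n) λ { k (s≤s k≤n) →
        cong (_·ₚ falling β k) (sym (truncate-≤ n (c n) k k≤n)) }))
  ; k<0⇒0 = λ n → truncate-neg n (c n)
  ; k>n⇒0 = λ n → truncate-> n (c n)
  }
  where
  e : ∀ n → ∃[ c ] rising α n ≈ₚ ∑ₚ< (suc n) (λ k → c k ·ₚ falling β k)
  e n = expand (falling β) (P-monic _) (P-bounded _) (suc n) (rising α n) (P-bounded _ n)

  c : ℕ → ℕ → ℤ
  c n = proj₁ (e n)

{-# OPTIONS --safe #-}

-- Multiplying the expansion of x(x + α)⋯(x + (n − 1)α) by x + nα and using
-- x + nα = (x − kβ) + (nα + kβ), the uniqueness of expansions in the monic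
-- basis of falling products gives S(n+1, k) = S(n, k−1) + (nα + kβ) S(n, k).
-- The sum over 1 ≤ i₁ ≤ ⋯ ≤ iₖ₊₁ ≤ n + 1 satisfies the same recurrence in the
-- form given by S(n+k, n): split it according to whether iₖ₊₁ = n + 1.

module Submission where

open import Defs
open import Data.Bool.Base using (Bool; true; false; if_then_else_; _∧_; T)
open import Data.Empty using (⊥-elim)
open import Data.Fin.Base using (toℕ)
open import Data.Integer.Base as ℤ using (ℤ; +_; 0ℤ; 1ℤ; -1ℤ)
import Data.Integer.Properties as ℤ
open import Algebra.Properties.AbelianGroup ℤ.+-0-abelianGroup using (∙-cancelʳ)
import Data.Integer.Tactic.RingSolver as ℤ-Solver
open import Data.List.Base
  using (List; []; _∷_; _++_; map; filter; tabulate; applyUpTo; cartesianProductWith)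
open import Data.List.Properties
  using (applyUpTo-∷ʳ; map-++; map-∘; map-cong; tabulate-cong)
open import Data.Nat.Base using (ℕ; zero; suc; _+_; _*_; _≤_; _<_; _≤ᵇ_; z≤n; s≤s)
open import Data.Nat.ListAction using (sum; product)
open import Data.Nat.ListAction.Properties using (sum-++)
import Data.Nat.Properties as ℕ
import Data.Nat.Tactic.RingSolver as ℕ-Solver
open import Data.Product.Base using (_×_; _,_)
open import Data.Vec.Base using (Vec; []; _∷_; lookup)
open import Data.Vec.Relation.Unary.Linked using (linked?)
open import Function.Base using (_∘_)
open import Relation.Binary.PropositionalEquality
  using (_≡_; refl; sym; trans; cong; cong₂; subst; module ≡-Reasoning)
open import Relation.Nullary.Decidable using (does; yes; no)
open import Relation.Unary using (Decidable)

open ≡-Reasoning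

-- Coefficients of polynomials

coeff-+ₚ : ∀ p q m → coeff (p +ₚ q) m ≡ coeff p m ℤ.+ coeff q m
coeff-+ₚ []      q       m       = sym (ℤ.+-identityˡ _)
coeff-+ₚ (a ∷ p) []      m       = sym (ℤ.+-identityʳ _)
coeff-+ₚ (a ∷ p) (b ∷ q) zero    = refl
coeff-+ₚ (a ∷ p) (b ∷ q) (suc m) = coeff-+ₚ p q m

coeff-·ₚ : ∀ c p m → coeff (c ·ₚ p) m ≡ c ℤ.* coeff p m
coeff-·ₚ c []      m       = sym (ℤ.*-zeroʳ c)
coeff-·ₚ c (a ∷ p) zero    = refl
coeff-·ₚ c (a ∷ p) (suc m) = coeff-·ₚ c p m

coeff-0∷·ₚ : ∀ c p m → coeff (0ℤ ∷ (c ·ₚ p)) m ≡ c ℤ.* coeff (0ℤ ∷ p) m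
coeff-0∷·ₚ c p zero    = sym (ℤ.*-zeroʳ c)
coeff-0∷·ₚ c p (suc m) = coeff-·ₚ c p m

-- Here `0ℤ ∷ p` stands for x p, which keeps the formula uniform in m, the constant coefficient
-- included.
coeff-*ₚ-x+ : ∀ p c m → coeff (p *ₚ (x+ c)) m ≡ coeff (0ℤ ∷ p) m ℤ.+ coeff p m ℤ.* c
coeff-*ₚ-x+ []      c zero          = refl
coeff-*ₚ-x+ []      c (suc m)       = refl
coeff-*ₚ-x+ (a ∷ p) c zero          = ℤ.+-comm (a ℤ.* c) 0ℤ
coeff-*ₚ-x+ (a ∷ p) c (suc zero)    = begin
  coeff ((a ℤ.* 1ℤ ∷ []) +ₚ p *ₚ (x+ c)) 0
    ≡⟨ coeff-+ₚ (a ℤ.* 1ℤ ∷ []) (p *ₚ (x+ c)) 0 ⟩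
  a ℤ.* 1ℤ ℤ.+ coeff (p *ₚ (x+ c)) 0
    ≡⟨ cong₂ ℤ._+_ (ℤ.*-identityʳ a) (coeff-*ₚ-x+ p c 0) ⟩
  a ℤ.+ (0ℤ ℤ.+ coeff p 0 ℤ.* c)
    ≡⟨ cong (λ y → a ℤ.+ y) (ℤ.+-identityˡ _) ⟩
  a ℤ.+ coeff p 0 ℤ.* c ∎
coeff-*ₚ-x+ (a ∷ p) c (suc (suc m)) = begin
  coeff ((a ℤ.* 1ℤ ∷ []) +ₚ p *ₚ (x+ c)) (suc m)
    ≡⟨ coeff-+ₚ (a ℤ.* 1ℤ ∷ []) (p *ₚ (x+ c)) (suc m) ⟩
  0ℤ ℤ.+ coeff (p *ₚ (x+ c)) (suc m)
    ≡⟨ ℤ.+-identityˡ _ ⟩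
  coeff (p *ₚ (x+ c)) (suc m)
    ≡⟨ coeff-*ₚ-x+ p c (suc m) ⟩
  coeff p m ℤ.+ coeff p (suc m) ℤ.* c ∎

*ₚ-x+-cong : ∀ p q c → p ≈ₚ q → p *ₚ (x+ c) ≈ₚ q *ₚ (x+ c)
*ₚ-x+-cong p q c p≈q m
  rewrite coeff-*ₚ-x+ p c m | coeff-*ₚ-x+ q c m =
  cong₂ ℤ._+_ (shift m) (cong (ℤ._* c) (p≈q m))
  where
  shift : (0ℤ ∷ p) ≈ₚ (0ℤ ∷ q)
  shift zero    = refl
  shift (suc m) = p≈q m

*ₚ-x+-distrib-+ₚ : ∀ p q c → (p +ₚ q) *ₚ (x+ c) ≈ₚ p *ₚ (x+ c) +ₚ q *ₚ (x+ c)
*ₚ-x+-distrib-+ₚ p q c m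
  rewrite coeff-+ₚ (p *ₚ (x+ c)) (q *ₚ (x+ c)) m
        | coeff-*ₚ-x+ (p +ₚ q) c m | coeff-*ₚ-x+ p c m | coeff-*ₚ-x+ q c m
        | coeff-+ₚ p q m | coeff-+ₚ (0ℤ ∷ p) (0ℤ ∷ q) m =
  ring (coeff (0ℤ ∷ p) m) (coeff (0ℤ ∷ q) m) (coeff p m) (coeff q m) c
  where
  ring : ∀ a b x y c → (a ℤ.+ b) ℤ.+ (x ℤ.+ y) ℤ.* c ≡ (a ℤ.+ x ℤ.* c) ℤ.+ (b ℤ.+ y ℤ.* c)
  ring = ℤ-Solver.solve-∀

·ₚ-*ₚ-x+ : ∀ s p c m → coeff ((s ·ₚ p) *ₚ (x+ c)) m ≡ s ℤ.* coeff (p *ₚ (x+ c)) m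
·ₚ-*ₚ-x+ s p c m
  rewrite coeff-*ₚ-x+ (s ·ₚ p) c m | coeff-*ₚ-x+ p c m
        | coeff-·ₚ s p m | coeff-0∷·ₚ s p m =
  ring s (coeff (0ℤ ∷ p) m) (coeff p m) c
  where
  ring : ∀ s a x c → s ℤ.* a ℤ.+ (s ℤ.* x) ℤ.* c ≡ s ℤ.* (a ℤ.+ x ℤ.* c)
  ring = ℤ-Solver.solve-∀

-- x + c = (x + d) + (c - d). With p a basis polynomial and d the constant of its next factor, p (x
-- + d) is the next basis polynomial.
*ₚ-x+-change : ∀ p c d m →
  coeff (p *ₚ (x+ c)) m ≡ coeff (p *ₚ (x+ d)) m ℤ.+ (c ℤ.- d) ℤ.* coeff p m
*ₚ-x+-change p c d m
  rewrite coeff-*ₚ-x+ p c m | coeff-*ₚ-x+ p d m =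
  ring (coeff (0ℤ ∷ p) m) (coeff p m) c d
  where
  ring : ∀ a x c d → a ℤ.+ x ℤ.* c ≡ (a ℤ.+ x ℤ.* d) ℤ.+ (c ℤ.- d) ℤ.* x
  ring = ℤ-Solver.solve-∀

-- Expansions in the Newton basis (x + r₀)(x + r₁)⋯

module Newton (r : ℕ → ℤ) where

  basis : ℕ → Poly
  basis n = ∏ₚ< n (λ i → x+ r i)

  expansion : ℕ → (ℕ → ℤ) → Poly
  expansion n s = ∑ₚ< n (λ k → s k ·ₚ basis k)

  coeff-expansion-suc : ∀ n s m →
    coeff (expansion (suc n) s) m ≡ coeff (expansion n s) m ℤ.+ s n ℤ.* coeff (basis n) m
  coeff-expansion-suc n s m =
    trans (coeff-+ₚ (expansion n s) _ m)
          (cong (λ y → coeff (expansion n s) m ℤ.+ y) (coeff-·ₚ (s n) (basis n) m))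

  basis-bounded : ∀ n m → n < m → coeff (basis n) m ≡ 0ℤ
  basis-bounded zero    (suc m) _ = refl
  basis-bounded (suc n) (suc m) (s≤s n<m)
    rewrite coeff-*ₚ-x+ (basis n) (r n) (suc m)
          | basis-bounded n m n<m
          | basis-bounded n (suc m) (ℕ.m<n⇒m<1+n n<m) = refl

  basis-monic : ∀ n → coeff (basis n) n ≡ 1ℤ
  basis-monic zero    = refl
  basis-monic (suc n)
    rewrite coeff-*ₚ-x+ (basis n) (r n) (suc n)
          | basis-monic n
          | basis-bounded n (suc n) ℕ.≤-refl = refl

  expansion-bounded : ∀ n s m → n ≤ m → coeff (expansion n s) m ≡ 0ℤ
  expansion-bounded zero    s m _ = refl
  expansion-bounded (suc n) s m n<m
    rewrite coeff-expansion-suc n s m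
          | expansion-bounded n s m (ℕ.<⇒≤ n<m)
          | basis-bounded n m n<m = trans (ℤ.+-identityˡ _) (ℤ.*-zeroʳ (s n))

  expansion-leading : ∀ n s → coeff (expansion (suc n) s) n ≡ s n
  expansion-leading n s
    rewrite coeff-expansion-suc n s n
          | expansion-bounded n s n ℕ.≤-refl
          | basis-monic n = trans (ℤ.+-identityˡ _) (ℤ.*-identityʳ (s n))

  -- The basis is triangular and monic, so the top coefficients agree by comparing leading
  -- coefficients; after cancelling those terms, induct on n.
  expansion-unique : ∀ n s t → expansion n s ≈ₚ expansion n t → ∀ k → k < n → s k ≡ t k
  expansion-unique (suc n) s t eq = go
    where
    sₙ≡tₙ : s n ≡ t n
    sₙ≡tₙ = trans (sym (expansion-leading n s)) (trans (eq n) (expansion-leading n t))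

    eq′ : expansion n s ≈ₚ expansion n t
    eq′ m = ∙-cancelʳ (s n ℤ.* coeff (basis n) m) _ _ (begin
      coeff (expansion n s) m ℤ.+ s n ℤ.* coeff (basis n) m
        ≡⟨ sym (coeff-expansion-suc n s m) ⟩
      coeff (expansion (suc n) s) m
        ≡⟨ eq m ⟩
      coeff (expansion (suc n) t) m
        ≡⟨ coeff-expansion-suc n t m ⟩
      coeff (expansion n t) m ℤ.+ t n ℤ.* coeff (basis n) m
        ≡⟨ cong (λ y → coeff (expansion n t) m ℤ.+ y ℤ.* coeff (basis n) m) (sym sₙ≡tₙ) ⟩
      coeff (expansion n t) m ℤ.+ s n ℤ.* coeff (basis n) m ∎)

    go : ∀ k → k < suc n → s k ≡ t k
    go k (s≤s k≤n) with k ℕ.≟ n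
    ... | yes refl = sₙ≡tₙ
    ... | no  k≢n  = expansion-unique n s t eq′ k (ℕ.≤∧≢⇒< k≤n k≢n)

  module _ (c : ℤ) (s t : ℕ → ℤ)
           (t-zero : t 0 ≡ (c ℤ.- r 0) ℤ.* s 0)
           (t-suc  : ∀ k → t (suc k) ≡ s k ℤ.+ (c ℤ.- r (suc k)) ℤ.* s (suc k)) where

    -- As x + c = (x + r k) + (c - r k), the term at k contributes `s k` to position k + 1 and (c -
    -- r k) `s k` to position k; together these give `t`. What the last term sends to position n + 1
    -- is left over.
    expansion-*ₚ-x+-step : ∀ n m →
      coeff (expansion (suc n) s *ₚ (x+ c)) m ≡
      coeff (expansion (suc n) t) m ℤ.+ s n ℤ.* coeff (basis (suc n)) m
    expansion-*ₚ-x+-step zero m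
      rewrite ·ₚ-*ₚ-x+ (s 0) (basis 0) c m
            | coeff-·ₚ (t 0) (basis 0) m
            | *ₚ-x+-change (basis 0) c (r 0) m
            | t-zero =
      ring (s 0) (c ℤ.- r 0) (coeff (basis 1) m) (coeff (basis 0) m)
      where
      ring : ∀ s e y x → s ℤ.* (y ℤ.+ e ℤ.* x) ≡ (e ℤ.* s) ℤ.* x ℤ.+ s ℤ.* y
      ring = ℤ-Solver.solve-∀
    expansion-*ₚ-x+-step (suc n) m
      rewrite *ₚ-x+-distrib-+ₚ (expansion (suc n) s) (s (suc n) ·ₚ basis (suc n)) c m
            | coeff-+ₚ (expansion (suc n) s *ₚ (x+ c))
                       ((s (suc n) ·ₚ basis (suc n)) *ₚ (x+ c)) m
            | expansion-*ₚ-x+-step n m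
            | ·ₚ-*ₚ-x+ (s (suc n)) (basis (suc n)) c m
            | *ₚ-x+-change (basis (suc n)) c (r (suc n)) m
            | coeff-expansion-suc (suc n) t m
            | t-suc n =
      ring (coeff (expansion (suc n) t) m) (s n) (coeff (basis (suc n)) m)
           (s (suc n)) (coeff (basis (suc (suc n))) m) (c ℤ.- r (suc n))
      where
      ring : ∀ w a x b y e →
        (w ℤ.+ a ℤ.* x) ℤ.+ b ℤ.* (y ℤ.+ e ℤ.* x) ≡
        (w ℤ.+ (a ℤ.+ e ℤ.* b) ℤ.* x) ℤ.+ b ℤ.* y
      ring = ℤ-Solver.solve-∀

    -- Once `s (suc n)` vanishes, `t (suc n)` is `s n`, so the left-over becomes the last term of
    -- the longer expansion.
    expansion-*ₚ-x+ : ∀ n → s (suc n) ≡ 0ℤ →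
      expansion (suc n) s *ₚ (x+ c) ≈ₚ expansion (suc (suc n)) t
    expansion-*ₚ-x+ n sₙ₊₁≡0 m = begin
      coeff (expansion (suc n) s *ₚ (x+ c)) m
        ≡⟨ expansion-*ₚ-x+-step n m ⟩
      coeff (expansion (suc n) t) m ℤ.+ s n ℤ.* coeff (basis (suc n)) m
        ≡⟨ cong (λ y → coeff (expansion (suc n) t) m ℤ.+ y ℤ.* coeff (basis (suc n)) m)
             (sym tₙ₊₁≡sₙ) ⟩
      coeff (expansion (suc n) t) m ℤ.+ t (suc n) ℤ.* coeff (basis (suc n)) m
        ≡⟨ sym (coeff-expansion-suc (suc n) t m) ⟩
      coeff (expansion (suc (suc n)) t) m ∎
      where
      tₙ₊₁≡sₙ : t (suc n) ≡ s n
      tₙ₊₁≡sₙ rewrite t-suc n | sₙ₊₁≡0 | ℤ.*-zeroʳ (c ℤ.- r (suc n)) = ℤ.+-identityʳ _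

-- The recurrence of the generalized Stirling numbers

module Stirling {α β : ℤ} {S : ℕ → ℤ → ℤ} (isS : IsGeneralizedStirling α β S) where

  open IsGeneralizedStirling isS renaming (expansion to S-expansion)
  -- With these constants `basis` unfolds to `falling β`.
  open Newton (λ i → ℤ.- (+ i ℤ.* β))

  -- The predecessor is taken in ℤ: at k = 0 it is -1, where `S n` vanishes, so one formula covers
  -- every k in the range compared by `expansion-unique`.
  S-step : ∀ n k → k ≤ suc n →
    S (suc n) (+ k) ≡ S n (ℤ.pred (+ k)) ℤ.+ (+ n ℤ.* α ℤ.+ + k ℤ.* β) ℤ.* S n (+ k)
  S-step n k k≤1+n =
    expansion-unique (suc (suc n)) (λ k → S (suc n) (+ k)) t
      (λ m → begin
        coeff (expansion (suc (suc n)) (λ k → S (suc n) (+ k))) m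
          ≡⟨ sym (S-expansion (suc n) m) ⟩
        coeff (rising α n *ₚ (x+ c)) m
          ≡⟨ *ₚ-x+-cong (rising α n) (expansion (suc n) s) c (S-expansion n) m ⟩
        coeff (expansion (suc n) s *ₚ (x+ c)) m
          ≡⟨ expansion-*ₚ-x+ c s t t-zero t-suc n
               (k>n⇒0 n (+ suc n) (ℤ.+<+ ℕ.≤-refl)) m ⟩
        coeff (expansion (suc (suc n)) t) m ∎)
      k (s≤s k≤1+n)
    where
    c = + n ℤ.* α

    s t : ℕ → ℤ
    s k = S n (+ k)
    t k = S n (ℤ.pred (+ k)) ℤ.+ (c ℤ.+ + k ℤ.* β) ℤ.* S n (+ k)

    neg-neg : ∀ x → c ℤ.+ x ≡ c ℤ.- (ℤ.- x)
    neg-neg x = cong (λ y → c ℤ.+ y) (sym (ℤ.neg-involutive x))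

    t-zero : t 0 ≡ (c ℤ.- (ℤ.- (+ 0 ℤ.* β))) ℤ.* s 0
    t-zero = trans
      (cong₂ ℤ._+_ (k<0⇒0 n -1ℤ ℤ.-<+) (cong (ℤ._* s 0) (neg-neg (+ 0 ℤ.* β))))
      (ℤ.+-identityˡ _)

    t-suc : ∀ k → t (suc k) ≡ s k ℤ.+ (c ℤ.- (ℤ.- (+ suc k ℤ.* β))) ℤ.* s (suc k)
    t-suc k = cong (λ y → s k ℤ.+ y ℤ.* s (suc k)) (neg-neg (+ suc k ℤ.* β))

  -- At k = n + 1 the second term of the recurrence carries S(n, n + 1) = 0, so the value 1 at n = 0
  -- is passed along the diagonal.
  S-diagonal : ∀ n → S n (+ n) ≡ 1ℤ
  S-diagonal zero    = trans (sym (expansion-leading 0 (λ k → S 0 (+ k)))) (sym (S-expansion 0 0))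
  S-diagonal (suc n)
    rewrite S-step n (suc n) ℕ.≤-refl
          | k>n⇒0 n (+ suc n) (ℤ.+<+ ℕ.≤-refl)
          | S-diagonal n
          | ℤ.*-zeroʳ (+ n ℤ.* α ℤ.+ + suc n ℤ.* β) = refl

  S-zero : ∀ n → S (suc n) (+ 0) ≡ 0ℤ
  S-zero n rewrite S-step n 0 z≤n | k<0⇒0 n -1ℤ ℤ.-<+ = vanish n
    where
    vanish : ∀ n → 0ℤ ℤ.+ (+ n ℤ.* α ℤ.+ + 0 ℤ.* β) ℤ.* S n (+ 0) ≡ 0ℤ
    -- For n = 0 the factor nα is 0; from n = 1 on, S(n, 0) is already 0 by induction.
    vanish zero    = refl
    vanish (suc n) rewrite S-zero n = trans (ℤ.+-identityˡ _) (ℤ.*-zeroʳ (+ suc n ℤ.* α ℤ.+ + 0 ℤ.* β))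

-- Finite sums

-- Unfolds at the upper end, because the recurrence compares the bounds n and n + 1.
∑₁ : ℕ → (ℕ → ℕ) → ℕ
∑₁ zero    f = 0
∑₁ (suc n) f = ∑₁ n f + f (suc n)

∑₁-cong : ∀ n {f g : ℕ → ℕ} → (∀ i → i ≤ n → f i ≡ g i) → ∑₁ n f ≡ ∑₁ n g
∑₁-cong zero    eq = refl
∑₁-cong (suc n) eq = cong₂ _+_ (∑₁-cong n λ i i≤n → eq i (ℕ.m≤n⇒m≤1+n i≤n)) (eq (suc n) ℕ.≤-refl)

∑₁-+-* : ∀ n c (f g : ℕ → ℕ) → ∑₁ n (λ i → f i + c * g i) ≡ ∑₁ n f + c * ∑₁ n g
∑₁-+-* zero    c f g = sym (ℕ.*-zeroʳ c)
∑₁-+-* (suc n) c f g rewrite ∑₁-+-* n c f g = ring (∑₁ n f) c (∑₁ n g) (f (suc n)) (g (suc n))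
  where
  ring : ∀ a c b x y → (a + c * b) + (x + c * y) ≡ (a + x) + c * (b + y)
  ring = ℕ-Solver.solve-∀

∑₁-zero : ∀ n {f : ℕ → ℕ} → (∀ i → i ≤ n → f i ≡ 0) → ∑₁ n f ≡ 0
∑₁-zero zero    eq = refl
∑₁-zero (suc n) eq =
  cong₂ _+_ (∑₁-zero n λ i i≤n → eq i (ℕ.m≤n⇒m≤1+n i≤n)) (eq (suc n) ℕ.≤-refl)

sum-applyUpTo-suc : ∀ n (f : ℕ → ℕ) → sum (map f (applyUpTo suc n)) ≡ ∑₁ n f
sum-applyUpTo-suc zero    f = refl
sum-applyUpTo-suc (suc n) f = begin
  sum (map f (applyUpTo suc (suc n)))
    ≡⟨ cong (sum ∘ map f) (sym (applyUpTo-∷ʳ suc n)) ⟩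
  sum (map f (applyUpTo suc n ++ suc n ∷ []))
    ≡⟨ cong sum (map-++ f (applyUpTo suc n) (suc n ∷ [])) ⟩
  sum (map f (applyUpTo suc n) ++ f (suc n) ∷ [])
    ≡⟨ sum-++ (map f (applyUpTo suc n)) (f (suc n) ∷ []) ⟩
  sum (map f (applyUpTo suc n)) + (f (suc n) + 0)
    ≡⟨ cong₂ _+_ (sum-applyUpTo-suc n f) (ℕ.+-identityʳ _) ⟩
  ∑₁ n f + f (suc n) ∎

-- Sums over filtered lists and cartesian products

module _ {A : Set} where

  -- Moves the condition on whole tuples into the summand, where it can be split entry by entry.
  sum-map-filter : ∀ {P : A → Set} (P? : Decidable P) (f : A → ℕ) xs →
    sum (map f (filter P? xs)) ≡ sum (map (λ x → if does (P? x) then f x else 0) xs)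
  sum-map-filter P? f []       = refl
  sum-map-filter P? f (x ∷ xs) with does (P? x)
  ... | true  = cong (λ y → f x + y) (sum-map-filter P? f xs)
  ... | false = sum-map-filter P? f xs

  -- For tuples with a fixed first entry, `b` is the test on that entry and `w` its factor; neither
  -- depends on the tail, so both leave the sum.
  sum-map-if-* : ∀ b w (f : A → ℕ) (B : A → Bool) xs →
    sum (map (λ x → if b ∧ B x then w * f x else 0) xs) ≡
    (if b then w * sum (map (λ x → if B x then f x else 0) xs) else 0)
  sum-map-if-* true  w f B []       = sym (ℕ.*-zeroʳ w)
  sum-map-if-* true  w f B (x ∷ xs) with B x
  ... | true  = trans (cong (λ y → w * f x + y) (sum-map-if-* true w f B xs))
                      (sym (ℕ.*-distribˡ-+ w (f x) _))
  ... | false = sum-map-if-* true w f B xs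
  sum-map-if-* false w f B []       = refl
  sum-map-if-* false w f B (x ∷ xs) = sum-map-if-* false w f B xs

sum-map-cartesianProductWith :
  ∀ {A B C : Set} (f : C → ℕ) (g : A → B → C) xs ys →
  sum (map f (cartesianProductWith g xs ys)) ≡ sum (map (λ x → sum (map (f ∘ g x) ys)) xs)
sum-map-cartesianProductWith f g []       ys = refl
sum-map-cartesianProductWith f g (x ∷ xs) ys = begin
  sum (map f (map (g x) ys ++ cartesianProductWith g xs ys))
    ≡⟨ cong sum (map-++ f (map (g x) ys) _) ⟩
  sum (map f (map (g x) ys) ++ map f (cartesianProductWith g xs ys))
    ≡⟨ sum-++ (map f (map (g x) ys)) _ ⟩
  sum (map f (map (g x) ys)) + sum (map f (cartesianProductWith g xs ys))
    ≡⟨ cong₂ _+_ (cong sum (sym (map-∘ ys))) (sum-map-cartesianProductWith f g xs ys) ⟩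
  sum (map (f ∘ g x) ys) + sum (map (λ x → sum (map (f ∘ g x) ys)) xs) ∎

≤⇒≤ᵇ≡true : ∀ {m n} → m ≤ n → (m ≤ᵇ n) ≡ true
≤⇒≤ᵇ≡true {m} {n} m≤n with m ≤ᵇ n | ℕ.≤⇒≤ᵇ m≤n
... | true | _ = refl

>⇒≤ᵇ≡false : ∀ {m n} → n < m → (m ≤ᵇ n) ≡ false
>⇒≤ᵇ≡false {m} {n} n<m with m ≤ᵇ n in eq
... | false = refl
... | true  = ⊥-elim (ℕ.<⇒≱ n<m (ℕ.≤ᵇ⇒≤ m n (subst T (sym eq) _)))

-- Sums of weights over weakly increasing tuples

module Chains (α β : ℕ) where

  factor : ℕ → ℕ → ℕ
  factor m i = (α + β) * i + α * m

  -- The sum of shiftedWeight α β m over j ≤ i₁ ≤ ⋯ ≤ iₖ ≤ n.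
  chainSum : (k n m j : ℕ) → ℕ
  chainSum zero    n m j = 1
  chainSum (suc k) n m j =
    ∑₁ n (λ i → if j ≤ᵇ i then factor m i * chainSum k n (suc m) i else 0)

  -- The range of i₁ is empty. The length is at least 1, since the empty tuple contributes 1.
  chainSum-zero : ∀ k n m j → n < j → chainSum (suc k) n m j ≡ 0
  chainSum-zero k n m j n<j =
    ∑₁-zero n λ i i≤n → cong (if_then _ else 0) (>⇒≤ᵇ≡false (ℕ.≤-<-trans i≤n n<j))

  -- Split by whether the last entry is n + 1. If so, it contributes the factor at offset m + k, and
  -- the other k entries still range up to n + 1. As `chainSum` peels off the first entry, the split
  -- reaches the last one by induction on k.
  chainSum-step : ∀ k n m j → j ≤ suc n →
    chainSum (suc k) (suc n) m j ≡
    chainSum (suc k) n m j + factor (m + k) (suc n) * chainSum k (suc n) m j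
  chainSum-step zero n m j j≤1+n
    rewrite ≤⇒≤ᵇ≡true j≤1+n | ℕ.+-identityʳ m = refl
  chainSum-step (suc k) n m j j≤1+n = begin
    chainSum (suc (suc k)) (suc n) m j
      ≡⟨ ∑₁-cong (suc n) split ⟩
    ∑₁ (suc n) (λ i → f i + c * g i)
      ≡⟨ ∑₁-+-* (suc n) c f g ⟩
    (∑₁ n f + f (suc n)) + c * ∑₁ (suc n) g
      ≡⟨ cong (λ y → (∑₁ n f + y) + c * ∑₁ (suc n) g) f-last ⟩
    (∑₁ n f + 0) + c * ∑₁ (suc n) g
      ≡⟨ cong (_+ c * ∑₁ (suc n) g) (ℕ.+-identityʳ (∑₁ n f)) ⟩
    ∑₁ n f + c * ∑₁ (suc n) g ∎
    where
    c = factor (m + suc k) (suc n)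

    -- For i₁ = i, `f` has all later entries at most n, while `c` times `g` has last entry n + 1.
    f g : ℕ → ℕ
    f i = if j ≤ᵇ i then factor m i * chainSum (suc k) n (suc m) i else 0
    g i = if j ≤ᵇ i then factor m i * chainSum k (suc n) (suc m) i else 0

    -- With i₁ = n + 1 the later entries would have to lie between n + 1 and n.
    f-last : f (suc n) ≡ 0
    f-last rewrite ≤⇒≤ᵇ≡true j≤1+n | chainSum-zero k n (suc m) (suc n) ℕ.≤-refl =
      ℕ.*-zeroʳ (factor m (suc n))

    ring : ∀ w x c y → w * (x + c * y) ≡ w * x + c * (w * y)
    ring = ℕ-Solver.solve-∀

    split : ∀ i → i ≤ suc n →
      (if j ≤ᵇ i then factor m i * chainSum (suc k) (suc n) (suc m) i else 0) ≡ f i + c * g i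
    split i i≤1+n with j ≤ᵇ i
    ... | false = sym (ℕ.*-zeroʳ c)
    ... | true
      rewrite chainSum-step k n (suc m) i i≤1+n | ℕ.+-suc m k =
      ring (factor m i) (chainSum (suc k) n (suc m) i)
           (factor (suc (m + k)) (suc n)) (chainSum k (suc n) (suc m) i)

  -- Prepending `j` encodes the lower bound j ≤ i₁ as one more link of the chain, so the recursion
  -- can hand i₁ on as the next bound.
  sum-tuples : ∀ k n m j →
    sum (map (λ is → if does (linked? ℕ._≤?_ (j ∷ is)) then shiftedWeight α β m is else 0)
             (tuples k (applyUpTo suc n)))
    ≡ chainSum k n m j
  sum-tuples zero    n m j = refl
  sum-tuples (suc k) n m j = begin
    sum (map _ (cartesianProductWith _∷_ (applyUpTo suc n) (tuples k (applyUpTo suc n))))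
      ≡⟨ sum-map-cartesianProductWith _ _∷_ (applyUpTo suc n) (tuples k (applyUpTo suc n)) ⟩
    sum (map _ (applyUpTo suc n))
      ≡⟨ cong sum (map-cong head-sum (applyUpTo suc n)) ⟩
    sum (map _ (applyUpTo suc n))
      ≡⟨ sum-applyUpTo-suc n _ ⟩
    chainSum (suc k) n m j ∎
    where
    head-sum : ∀ i →
      sum (map (λ is → if does (linked? ℕ._≤?_ (j ∷ i ∷ is))
                       then shiftedWeight α β m (i ∷ is) else 0)
               (tuples k (applyUpTo suc n)))
      ≡ (if j ≤ᵇ i then factor m i * chainSum k n (suc m) i else 0)
    head-sum i = trans
      -- The test on `j ∷ i ∷ is` computes to the conjunction of `j ≤ᵇ i` and the test on `i ∷ is`.
      (sum-map-if-* (j ≤ᵇ i) (factor m i) (shiftedWeight α β (suc m))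
        (λ is → does (linked? ℕ._≤?_ (i ∷ is))) (tuples k (applyUpTo suc n)))
      (cong (λ y → if j ≤ᵇ i then factor m i * y else 0) (sum-tuples k n (suc m) i))

  ∑-weaklyIncreasing-cong : ∀ k n {f g : Vec ℕ k → ℕ} → (∀ is → f is ≡ g is) →
    ∑-weaklyIncreasing k n f ≡ ∑-weaklyIncreasing k n g
  ∑-weaklyIncreasing-cong k n eq = cong sum (map-cong eq (weaklyIncreasing k n))

  ∑-shiftedWeight : ∀ k n →
    ∑-weaklyIncreasing k n (shiftedWeight α β 0) ≡ chainSum k n 0 0
  ∑-shiftedWeight k n = begin
    ∑-weaklyIncreasing k n (shiftedWeight α β 0)
      ≡⟨ sum-map-filter (linked? ℕ._≤?_) (shiftedWeight α β 0) (tuples k (applyUpTo suc n)) ⟩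
    sum (map _ (tuples k (applyUpTo suc n)))
      ≡⟨ cong sum (map-cong prepend-0 (tuples k (applyUpTo suc n))) ⟩
    sum (map _ (tuples k (applyUpTo suc n)))
      ≡⟨ sum-tuples k n 0 0 ⟩
    chainSum k n 0 0 ∎
    where
    -- The bound 0 excludes nothing: `0 ≤ᵇ i` computes to `true`.
    prepend-0 : ∀ {k} (is : Vec ℕ k) →
      (if does (linked? ℕ._≤?_ is) then shiftedWeight α β 0 is else 0) ≡
      (if does (linked? ℕ._≤?_ (0 ∷ is)) then shiftedWeight α β 0 is else 0)
    prepend-0 []       = refl
    prepend-0 (i ∷ is) = refl

  -- The general offset `m` carries the induction: position j + 1 at offset m is position j of the
  -- tail at offset m + 1.
  shiftedWeight-product : ∀ {k} m (is : Vec ℕ k) →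
    product (tabulate λ j → factor (m + toℕ j) (lookup is j)) ≡ shiftedWeight α β m is
  shiftedWeight-product m []       = refl
  shiftedWeight-product m (i ∷ is) = cong₂ _*_
    (cong (λ y → factor y i) (ℕ.+-identityʳ m))
    (trans (cong product (tabulate-cong λ j →
             cong (λ y → factor y (lookup is j)) (ℕ.+-suc m (toℕ j))))
           (shiftedWeight-product (suc m) is))

  weight≡shiftedWeight : ∀ {k} (is : Vec ℕ k) → weight α β is ≡ shiftedWeight α β 0 is
  weight≡shiftedWeight = shiftedWeight-product 0

  shiftedWeight≡expandedWeight : ∀ {k} (is : Vec ℕ k) →
    shiftedWeight α β 0 is ≡ expandedWeight α β is
  shiftedWeight≡expandedWeight []       = refl
  shiftedWeight≡expandedWeight (i ∷ is) = cong (_* shiftedWeight α β 1 is)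
    (trans (cong (λ y → (α + β) * i + y) (ℕ.*-zeroʳ α)) (ℕ.+-identityʳ _))

  -- Stirling numbers as chain sums

  module _ {S : ℕ → ℤ → ℤ} (isS : IsGeneralizedStirling (+ α) (+ β) S) where

    open Stirling isS

    -- Induction on n and k. Both sides are 1 for k = 0, and 0 for n = 0 < k; otherwise the two
    -- terms of `S-step` are the cases (n, k + 1) and (n + 1, k), matching those of `chainSum-step`.
    stirling≡chainSum : ∀ n k → S (n + k) (+ n) ≡ + chainSum k n 0 0
    stirling≡chainSum n       zero    rewrite ℕ.+-identityʳ n = S-diagonal n
    stirling≡chainSum zero    (suc k) = S-zero k
    stirling≡chainSum (suc n) (suc k) = begin
      S (suc (n + suc k)) (+ suc n)
        ≡⟨ S-step (n + suc k) (suc n) (s≤s (ℕ.m≤m+n n (suc k))) ⟩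
      S (n + suc k) (+ n) ℤ.+ (+ (n + suc k) ℤ.* + α ℤ.+ + suc n ℤ.* + β) ℤ.* S (n + suc k) (+ suc n)
        ≡⟨ cong₂ ℤ._+_ (stirling≡chainSum n (suc k)) (cong₂ ℤ._*_ coefficient
             (trans (cong (λ y → S y (+ suc n)) (ℕ.+-suc n k)) (stirling≡chainSum (suc n) k))) ⟩
      + chainSum (suc k) n 0 0 ℤ.+ + factor k (suc n) ℤ.* + chainSum k (suc n) 0 0
        ≡⟨ cong (λ y → + chainSum (suc k) n 0 0 ℤ.+ y) (sym (ℤ.pos-* (factor k (suc n)) _)) ⟩
      + (chainSum (suc k) n 0 0 + factor k (suc n) * chainSum k (suc n) 0 0)
        ≡⟨ cong +_ (sym (chainSum-step k n 0 0 z≤n)) ⟩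
      + chainSum (suc k) (suc n) 0 0 ∎
      where
      ring : ∀ n k α β → (n + suc k) * α + suc n * β ≡ (α + β) * suc n + α * k
      ring = ℕ-Solver.solve-∀

      -- The recurrence coefficient (n + k + 1)α + (n + 1)β regroups into the factor of the last
      -- entry n + 1 at offset k.
      coefficient : + (n + suc k) ℤ.* + α ℤ.+ + suc n ℤ.* + β ≡ + factor k (suc n)
      coefficient = trans
        (cong₂ ℤ._+_ (sym (ℤ.pos-* (n + suc k) α)) (sym (ℤ.pos-* (suc n) β)))
        (cong +_ (ring n k α β))

theorem6 : ∀ (n k α β : ℕ) (S : ℕ → ℤ → ℤ) → IsGeneralizedStirling (+ α) (+ β) S →
    (S (n + k) (+ n) ≡ + ∑-weaklyIncreasing k n (weight α β))
    × (∑-weaklyIncreasing k n (weight α β) ≡ ∑-weaklyIncreasing k n (expandedWeight α β))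
theorem6 n k α β S isS =
    trans (stirling≡chainSum isS n k) (cong +_ (sym (trans
      (∑-weaklyIncreasing-cong k n weight≡shiftedWeight) (∑-shiftedWeight k n))))
  , ∑-weaklyIncreasing-cong k n λ is →
      trans (weight≡shiftedWeight is) (shiftedWeight≡expandedWeight is)
  where open Chains α β
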